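{- Let $\mathcal{T}$ be a stacked component (with vertex set $\{0,1,\dots,2\,\mathrm{ord}(\ell)-1\}$ and edges as specified in the context), and let $v\in V(\mathcal{T})$. Then $$\mathrm{ecc}(v)=\begin{cases}\frac12(\mathrm{ord}(\ell)+1) & \text{if } 2\nmid v,\\ \frac12(\mathrm{ord}(\ell)+3) & \text{if } 2\mid v.\end{cases}$$
   Context: Let $p$ be a prime with $p\equiv 71$ or $119\pmod{120}$, let $\ell=2$, and let $\mathrm{ord}(\ell)$ be the order, in the ideal class group of $\mathbb{Q}(\sqrt{ -p})$, of a prime ideal above $2$; it is an odd integer $\ge 3$. A stacked component $\mathcal{T}$ (a component of the supersingular $2$-isogeny graph over $\mathbb{F}_p$ after identifying curves up to $\overline{\mathbb{F}_p}$-isomorphism, regarded as a simple undirected graph) is, writing $L=\mathrm{ord}(\ell)$, labelled so that $V(\mathcal{T})=\{0,1,\dots,2L-1\}$ and $$E(\mathcal{T})=\{\{2i,2i+1\}:0\le i\le L-1\}\cup\{\{2i+1,2i+3\}:0\le i\le L-2\}\cup\{\{2L-1,1\}\}.$$ The eccentricity $\mathrm{ecc}(v)$ is the maximum graph distance from $v$ to any vertex of $\mathcal{T}$. -}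

module Defs where

open import Data.Fin using (Fin; toℕ)
open import Data.Integer as ℤ using (ℤ)
open import Data.List using (List; []; _∷_)
open import Data.Nat using (ℕ; zero; suc; _+_; _*_; _∸_; _≤_; _<_)
open import Data.Product using (Σ; ∃; _×_)
open import Data.Rational as ℚ using (ℚ; 0ℚ; 1ℚ)
open import Data.Sum using (_⊎_)
open import Function using (_on_)
open import Level using (0ℓ)
open import Relation.Binary using (Rel)
open import Relation.Binary.Construct.Closure.Symmetric using (SymClosure)
open import Relation.Binary.PropositionalEquality using (_≡_; _≢_)
open import Relation.Nullary using (¬_)
open import Relation.Unary using (Pred; _∈_; _∉_; _⊆_; _≐_)

------------------------------------------------------------------------
-- ℚ(√-p), its ring of integers and its ideal classes

module ImaginaryQuadratic (p : ℕ) where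

  infixl 6 _⊞_
  infixl 7 _⊠_

  -- re +√ im stands for re + im √-p.
  record K : Set where
    constructor _+√_
    field
      re im : ℚ

  open K

  _⊞_ : K → K → K
  x ⊞ y = (re x ℚ.+ re y) +√ (im x ℚ.+ im y)

  _⊠_ : K → K → K
  x ⊠ y = (re x ℚ.* re y ℚ.- (ℤ.+ p ℚ./ 1) ℚ.* (im x ℚ.* im y))
          +√ (re x ℚ.* im y ℚ.+ im x ℚ.* re y)

  fromℤ : ℤ → K
  fromℤ n = (n ℚ./ 1) +√ 0ℚ

  0K 1K 2K : K
  0K = fromℤ (ℤ.+ 0)
  1K = fromℤ (ℤ.+ 1)
  2K = fromℤ (ℤ.+ 2)

  -- c₀ ∷ … ∷ cₙ₋₁ ∷ [] encodes c₀ + c₁X + … + cₙ₋₁Xⁿ⁻¹ + Xⁿ; the leading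
  -- coefficient 1 is not listed.
  evalMonic : List ℤ → K → K
  evalMonic []       x = 1K
  evalMonic (c ∷ cs) x = fromℤ c ⊞ x ⊠ evalMonic cs x

  𝓞 : Pred K 0ℓ
  𝓞 x = Σ (List ℤ) λ cs → evalMonic cs x ≡ 0K

  record IsIdeal (I : Pred K 0ℓ) : Set where
    field
      integral  : I ⊆ 𝓞
      zero∈     : 0K ∈ I
      +-closed  : ∀ {x y} → x ∈ I → y ∈ I → x ⊞ y ∈ I
      *-absorbs : ∀ {r x} → r ∈ 𝓞 → x ∈ I → r ⊠ x ∈ I

  record IsPrimeIdeal (P : Pred K 0ℓ) : Set where
    field
      isIdeal : IsIdeal P
      proper  : 1K ∉ P
      prime   : ∀ {x y} → x ∈ 𝓞 → y ∈ 𝓞 → x ⊠ y ∈ P → x ∈ P ⊎ y ∈ P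

  IsPrimeIdealAbove2 : Pred K 0ℓ → Set
  IsPrimeIdealAbove2 P = IsPrimeIdeal P × 2K ∈ P

  -- The ideal product: finite sums of products.
  data _·_ (I J : Pred K 0ℓ) : Pred K 0ℓ where
    nil  : 0K ∈ I · J
    cons : ∀ {x y z} → x ∈ I → y ∈ J → z ∈ I · J → x ⊠ y ⊞ z ∈ I · J

  power : Pred K 0ℓ → ℕ → Pred K 0ℓ
  power I zero    = 𝓞
  power I (suc n) = I · power I n

  scale : K → Pred K 0ℓ → Pred K 0ℓ
  scale α I z = ∃ λ x → x ∈ I × z ≡ α ⊠ x

  SameClass : Rel (Pred K 0ℓ) _
  SameClass I J = ∃ λ α → ∃ λ β →
    α ∈ 𝓞 × β ∈ 𝓞 × α ≢ 0K × β ≢ 0K × scale α I ≐ scale β J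

  -- n is the order of the class of I in the ideal class group.
  IsClassOrder : Pred K 0ℓ → ℕ → Set
  IsClassOrder I n =
    1 ≤ n × SameClass (power I n) 𝓞 ×
    (∀ m → 1 ≤ m → m < n → ¬ SameClass (power I m) 𝓞)

open ImaginaryQuadratic public
  using (K; IsPrimeIdealAbove2; IsClassOrder)

------------------------------------------------------------------------
-- Distance and eccentricity in a graph given by its adjacency relation

module _ {V : Set} (Adj : Rel V 0ℓ) where

  data Walk : ℕ → V → V → Set where
    stop : ∀ {u} → Walk 0 u u
    step : ∀ {n u v w} → Adj u v → Walk n v w → Walk (suc n) u w

  IsDistance : V → V → ℕ → Set
  IsDistance u v d = Walk d u v × (∀ n → Walk n u v → d ≤ n)

  -- The upper bound also asks every vertex to be reachable from v; otherwise
  -- vertices in other components would be silently ignored.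
  IsEccentricity : V → ℕ → Set
  IsEccentricity v e =
    (∃ λ w → IsDistance v w e) ×
    (∀ w → ∃ λ d → IsDistance v w d × d ≤ e)

------------------------------------------------------------------------
-- Stacked components

data StackedEdge (L : ℕ) : Rel ℕ 0ℓ where
  pendant : ∀ i → i + 1 ≤ L → StackedEdge L (2 * i) (2 * i + 1)
  along   : ∀ i → i + 2 ≤ L → StackedEdge L (2 * i + 1) (2 * i + 3)
  closing : StackedEdge L (2 * L ∸ 1) 1

StackedVertex : ℕ → Set
StackedVertex L = Fin (2 * L)

StackedAdj : (L : ℕ) → Rel (StackedVertex L) 0ℓ
StackedAdj L = SymClosure (StackedEdge L) on toℕ

{-# OPTIONS --safe #-}

-- Contracting the pendant edges maps a stacked component onto a cycle of odd
-- length L = 2k + 1, so two distinct vertices are at distance (cyclic distance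
-- of their images) + (number of pendant vertices among the two).  The cyclic
-- distance is at most k, and k is attained by a pendant vertex.  For the lower
-- bound on distances, a walk on the cycle with x forward and y backward steps
-- from a to b satisfies a + x ≡ b + y (mod L), which forces x + y to be at
-- least the cyclic distance.
module Submission where

open import Defs
open import Level using (0ℓ)
open import Data.Empty using (⊥-elim)
open import Data.Fin using (toℕ; fromℕ<)
import Data.Fin.Properties as Fin
open import Data.Nat
  using (ℕ; zero; suc; _+_; _*_; _∸_; _≤_; _<_; z≤n; s≤s; ⌊_/2⌋)
open import Data.Nat.Divisibility using (_∣_; _∤_; divides)
open import Data.Nat.DivMod using (_/_; _%_; m*n/n≡m)
open import Data.Nat.Primality using (Prime)
open import Data.Nat.Properties
open import Data.Nat.Tactic.RingSolver using (solve-∀)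
open import Data.Product using (∃; ∃₂; _×_; _,_)
open import Data.Sum using (_⊎_; inj₁; inj₂; [_,_]′)
open import Relation.Binary using (Rel; Symmetric)
open import Relation.Binary.Construct.Closure.Symmetric
  using (SymClosure; fwd; bwd; symmetric)
open import Relation.Binary.PropositionalEquality
  using (_≡_; _≢_; refl; sym; trans; cong; cong₂; subst; subst₂)
open import Relation.Nullary using (yes; no)
open import Relation.Unary using (Pred)

-- Concatenation and reversal of walks

module _ {V : Set} {Adj : Rel V 0ℓ} where

  _++ʷ_ : ∀ {m n u v w} → Walk Adj m u v → Walk Adj n v w → Walk Adj (m + n) u w
  stop     ++ʷ q = q
  step e p ++ʷ q = step e (p ++ʷ q)

  reverseʷ : Symmetric Adj → ∀ {n u v} → Walk Adj n u v → Walk Adj n v u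
  reverseʷ _     stop               = stop
  reverseʷ sym-A (step {n} {u} {w = w} e p) =
    subst (λ m → Walk Adj m w u) (+-comm n 1)
      (reverseʷ sym-A p ++ʷ step (sym-A e) stop)

-- Parity, heights and positions of vertex numbers

-- The vertices 2i and 2i + 1 both lie over the position i = ⌊ x /2⌋ of the
-- cycle, at heights 1 and 0.
height : ℕ → ℕ
height 0             = 1
height 1             = 0
height (suc (suc x)) = height x

height≤1 : ∀ x → height x ≤ 1
height≤1 0             = ≤-refl
height≤1 1             = z≤n
height≤1 (suc (suc x)) = height≤1 x

height-even : ∀ i → height (2 * i) ≡ 1
height-even zero    = refl
height-even (suc i) rewrite +-suc i (i + 0) = height-even i

height-odd : ∀ i → height (2 * i + 1) ≡ 0
height-odd zero    = refl
height-odd (suc i) rewrite +-suc i (i + 0) = height-odd i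

⌊even/2⌋ : ∀ i → ⌊ 2 * i /2⌋ ≡ i
⌊even/2⌋ zero    = refl
⌊even/2⌋ (suc i) rewrite +-suc i (i + 0) = cong suc (⌊even/2⌋ i)

⌊odd/2⌋ : ∀ i → ⌊ 2 * i + 1 /2⌋ ≡ i
⌊odd/2⌋ zero    = refl
⌊odd/2⌋ (suc i) rewrite +-suc i (i + 0) = cong suc (⌊odd/2⌋ i)

2*i+3≡2*[1+i]+1 : ∀ i → 2 * i + 3 ≡ 2 * suc i + 1
2*i+3≡2*[1+i]+1 = solve-∀

2*[1+i]∸1≡2*i+1 : ∀ i → 2 * suc i ∸ 1 ≡ 2 * i + 1
2*[1+i]∸1≡2*i+1 i rewrite +-suc i (i + 0) = +-comm 1 (2 * i)

data EvenOrOdd : ℕ → Set where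
  even : ∀ i → EvenOrOdd (2 * i)
  odd  : ∀ i → EvenOrOdd (2 * i + 1)

evenOrOdd : ∀ x → EvenOrOdd x
evenOrOdd zero = even 0
evenOrOdd (suc x) with evenOrOdd x
... | even i = subst EvenOrOdd (+-comm (2 * i) 1) (odd i)
... | odd i  = subst EvenOrOdd (eq i) (even (suc i))
  where
  eq : ∀ i → 2 * suc i ≡ suc (2 * i + 1)
  eq = solve-∀

2∣⇒height≡1 : ∀ {x} → 2 ∣ x → height x ≡ 1
2∣⇒height≡1 (divides q refl) rewrite *-comm q 2 = height-even q

2∤⇒odd : ∀ {x} → 2 ∤ x → ∃ λ i → x ≡ 2 * i + 1
2∤⇒odd {x} 2∤x with evenOrOdd x
... | even i = ⊥-elim (2∤x (divides i (*-comm 2 i)))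
... | odd i  = i , refl

2∤⇒height≡0 : ∀ {x} → 2 ∤ x → height x ≡ 0
2∤⇒height≡0 2∤x with i , refl ← 2∤⇒odd 2∤x = height-odd i

odd< : ∀ {i L} → i < L → 2 * i + 1 < 2 * L
odd< {i} {L} i<L = subst (_≤ 2 * L) (eq i) (*-monoʳ-≤ 2 i<L)
  where
  eq : ∀ i → 2 * suc i ≡ suc (2 * i + 1)
  eq = solve-∀

even< : ∀ {i L} → i < L → 2 * i < 2 * L
even< = *-monoʳ-< 2

⌊/2⌋< : ∀ {x L} → x < 2 * L → ⌊ x /2⌋ < L
⌊/2⌋< {x} {L} x<2L with evenOrOdd x
... | even i rewrite ⌊even/2⌋ i = *-cancelˡ-< 2 i L x<2L
... | odd i  rewrite ⌊odd/2⌋ i  =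
  *-cancelˡ-< 2 i L (≤-<-trans (m≤m+n (2 * i) 1) x<2L)

-- Displacements modulo `L`

module _ (L : ℕ) where

  -- a + x ≡ b + y (mod L)
  record Span (a b x y : ℕ) : Set where
    constructor span
    field
      s t        : ℕ
      congruence : a + x + s * L ≡ b + y + t * L

  span-sym : ∀ {a b x y} → Span a b x y → Span b a y x
  span-sym (span s t eq) = span t s (sym eq)

  span-trans : ∀ {a b c x y x′ y′} →
    Span a b x y → Span b c x′ y′ → Span a c (x + x′) (y + y′)
  span-trans {a} {b} {c} {x} {y} {x′} {y′} (span s t eq) (span s′ t′ eq′) =
    -- The sum of the two congruences has `b` on both sides, where it cancels.
    span (s + s′) (t + t′) (+-cancelˡ-≡ b _ _ (begin
      b + (a + (x + x′) + (s + s′) * L)          ≡⟨ shuffle a b x x′ s s′ L ⟩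
      (a + x + s * L) + (b + x′ + s′ * L)        ≡⟨ cong₂ _+_ eq eq′ ⟩
      (b + y + t * L) + (c + y′ + t′ * L)        ≡⟨ shuffle′ b c y y′ t t′ L ⟩
      b + (c + (y + y′) + (t + t′) * L)          ∎))
    where
    open Relation.Binary.PropositionalEquality.≡-Reasoning
    shuffle : ∀ a b x x′ s s′ L → b + (a + (x + x′) + (s + s′) * L) ≡
                                  (a + x + s * L) + (b + x′ + s′ * L)
    shuffle = solve-∀
    shuffle′ : ∀ b c y y′ t t′ L → (b + y + t * L) + (c + y′ + t′ * L) ≡
                                   b + (c + (y + y′) + (t + t′) * L)
    shuffle′ = solve-∀

  -- Cancelling `a` leaves `x + s * L ≡ y + d + t * L`. If `s ≤ t`, then `x` is at least `y + d`.
  -- Otherwise `y + d` is at least `L`, hence at least `2 * d`, so `y` is at least `d`.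
  span-loop-≤ : ∀ {a x y d} → 2 * d ≤ L → Span a a x (y + d) → d ≤ x + y
  span-loop-≤ {a} {x} {y} {d} 2d≤L (span s t eq) =
    [ s≤t⇒ , t<s⇒ ]′ (≤-<-connex s t)
    where
    open ≤-Reasoning
    eq′ : x + s * L ≡ (y + d) + t * L
    eq′ = +-cancelˡ-≡ a _ _
      (trans (sym (+-assoc a x _)) (trans eq (+-assoc a (y + d) _)))
    s≤t⇒ : s ≤ t → d ≤ x + y
    s≤t⇒ s≤t = begin
      d      ≤⟨ m≤n+m d y ⟩
      y + d  ≤⟨ +-cancelʳ-≤ (s * L) (y + d) x (begin
        y + d + s * L  ≤⟨ +-monoʳ-≤ (y + d) (*-monoˡ-≤ L s≤t) ⟩
        y + d + t * L  ≡⟨ eq′ ⟨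
        x + s * L      ∎) ⟩
      x      ≤⟨ m≤m+n x y ⟩
      x + y  ∎
    L≤y+d : t < s → L ≤ y + d
    L≤y+d t<s = +-cancelʳ-≤ (t * L) L (y + d) (begin
      L + t * L        ≤⟨ *-monoˡ-≤ L t<s ⟩
      s * L            ≤⟨ m≤n+m (s * L) x ⟩
      x + s * L        ≡⟨ eq′ ⟩
      y + d + t * L    ∎)
    t<s⇒ : t < s → d ≤ x + y
    t<s⇒ t<s = begin
      d      ≤⟨ +-cancelʳ-≤ d d y (begin
        d + d  ≡⟨ cong (d +_) (+-identityʳ d) ⟨
        2 * d  ≤⟨ 2d≤L ⟩
        L      ≤⟨ L≤y+d t<s ⟩
        y + d  ∎) ⟩
      y      ≤⟨ m≤n+m y x ⟩
      x + y  ∎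

  -- An arc of length `d` between `a` and `b`, traversed purely forward or purely backward from `a`.
  Offset : ℕ → ℕ → ℕ → Set
  Offset a b d = Span a b d 0 ⊎ Span a b 0 d

  offset-sym : ∀ {a b d} → Offset a b d → Offset b a d
  offset-sym (inj₁ sp) = inj₂ (span-sym sp)
  offset-sym (inj₂ sp) = inj₁ (span-sym sp)

  -- Returning from `b` to `a` along the arc of length `d` closes the displacement to a loop at `a`,
  -- to which `span-loop-≤` applies.
  offset-≤ : ∀ {a b d x y} → 2 * d ≤ L → Offset a b d → Span a b x y → d ≤ x + y
  offset-≤ {d = d} {x} {y} 2d≤L (inj₁ ab) xy =
    subst (λ z → d ≤ z + y) (+-identityʳ x)
      (span-loop-≤ 2d≤L (span-trans xy (span-sym ab)))
  offset-≤ {d = d} {x} {y} 2d≤L (inj₂ ab) xy =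
    subst (d ≤_) (trans (cong (_+ x) (+-identityʳ y)) (+-comm y x))
      (span-loop-≤ 2d≤L (span-sym (span-trans xy (span-sym ab))))

  -- Lower bound on the length of walks

  Adj : Rel (StackedVertex L) 0ℓ
  Adj = StackedAdj L

  adj-sym : Symmetric Adj
  adj-sym = symmetric (StackedEdge L)

  pos : StackedVertex L → ℕ
  pos v = ⌊ toℕ v /2⌋

  pos< : ∀ v → pos v < L
  pos< v = ⌊/2⌋< (Fin.toℕ<n v)

  ht : StackedVertex L → ℕ
  ht v = height (toℕ v)

  -- The unit length of an edge pays either for one move along the cycle, both ends having height 0,
  -- or for the height of its pendant end, the position being unchanged.
  UnitSpan : Rel ℕ 0ℓ
  UnitSpan x y = ∃₂ λ p q →
    Span ⌊ x /2⌋ ⌊ y /2⌋ p q × height x + height y + (p + q) ≤ 1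

  edge-span : ∀ {x y} → 1 ≤ L → StackedEdge L x y → UnitSpan x y
  edge-span _ (pendant i _)
    rewrite height-even i | height-odd i | ⌊even/2⌋ i | ⌊odd/2⌋ i =
    0 , 0 , span 0 0 refl , ≤-refl
  edge-span _ (along i _)
    rewrite 2*i+3≡2*[1+i]+1 i | height-odd i | height-odd (suc i)
          | ⌊odd/2⌋ i | ⌊odd/2⌋ (suc i) =
    1 , 0 , span 0 0 (shift i) , ≤-refl
    where
    shift : ∀ i → i + 1 + 0 ≡ suc i + 0 + 0
    shift = solve-∀
  edge-span (s≤s {n = m} _) closing
    rewrite 2*[1+i]∸1≡2*i+1 m | height-odd m | ⌊odd/2⌋ m =
    -- A forward move from the last position `m` to 0 completes a turn, which `t = 1` records.
    1 , 0 , span 0 1 (shift m) , ≤-refl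
    where
    shift : ∀ m → m + 1 + 0 ≡ 0 + 0 + 1 * suc m
    shift = solve-∀

  adj-span : ∀ {x y} → 1 ≤ L → SymClosure (StackedEdge L) x y → UnitSpan x y
  adj-span 1≤L (fwd e) = edge-span 1≤L e
  adj-span {x} {y} 1≤L (bwd e) with p , q , sp , le ← edge-span 1≤L e =
    q , p , span-sym sp ,
    subst (_≤ 1) (cong₂ _+_ (+-comm (height y) (height x)) (+-comm p q)) le

  -- Costs of edges add up along the walk; the heights of intermediate vertices are counted twice
  -- and discarded. The empty walk needs its own alternative, since at a pendant vertex the two end
  -- heights already sum to 2.
  walk-span : ∀ {n u v} → 1 ≤ L → Walk Adj n u v →
    u ≡ v ⊎ ∃₂ λ p q → Span (pos u) (pos v) p q × ht u + ht v + (p + q) ≤ n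
  walk-span _ stop = inj₁ refl
  walk-span 1≤L (step {n} {u} {w} {v} e W)
    with p , q , sp , le ← adj-span 1≤L e | walk-span 1≤L W
  ... | inj₁ refl = inj₂ (p , q , sp , ≤-trans le (s≤s z≤n))
  ... | inj₂ (p′ , q′ , sp′ , le′) =
    inj₂ (p + p′ , q + q′ , span-trans sp sp′ , (begin
      ht u + ht v + (p + p′ + (q + q′))
        ≤⟨ m≤m+n _ (ht w + ht w) ⟩
      ht u + ht v + (p + p′ + (q + q′)) + (ht w + ht w)
        ≡⟨ shuffle (ht u) (ht v) (ht w) p q p′ q′ ⟩
      (ht u + ht w + (p + q)) + (ht w + ht v + (p′ + q′))
        ≤⟨ +-mono-≤ le le′ ⟩
      suc n ∎))
    where
    open ≤-Reasoning
    shuffle : ∀ a b c p q p′ q′ → a + b + (p + p′ + (q + q′)) + (c + c) ≡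
                                  (a + c + (p + q)) + (c + b + (p′ + q′))
    shuffle = solve-∀

  -- Explicit walks and exact distances

  cyc : ∀ {i} → i < L → StackedVertex L
  cyc i<L = fromℕ< (odd< i<L)

  toℕ-cyc : ∀ {i} (i<L : i < L) → toℕ (cyc i<L) ≡ 2 * i + 1
  toℕ-cyc i<L = Fin.toℕ-fromℕ< (odd< i<L)

  base : StackedVertex L → StackedVertex L
  base v = cyc (pos< v)

  descend : ∀ v → Walk Adj (ht v) v (base v)
  -- `toℕ v` is generalised to a variable so that the parity cases can determine it.
  descend v = go (toℕ v) refl (evenOrOdd (toℕ v))
    where
    go : ∀ x → toℕ v ≡ x → EvenOrOdd x → Walk Adj (ht v) v (base v)
    go _ eq (even i) =
      subst (λ n → Walk Adj n v (base v)) (sym (trans (cong height eq) (height-even i)))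
        (step (fwd (subst₂ (StackedEdge L) (sym eq) (sym base≡)
                 (pendant i (subst (_≤ L) (+-comm 1 i) i<L))))
              stop)
      where
      pos≡ : pos v ≡ i
      pos≡ = trans (cong ⌊_/2⌋ eq) (⌊even/2⌋ i)
      i<L : i < L
      i<L = subst (_< L) pos≡ (pos< v)
      base≡ : toℕ (base v) ≡ 2 * i + 1
      base≡ = trans (toℕ-cyc (pos< v)) (cong (λ j → 2 * j + 1) pos≡)
    go _ eq (odd i) =
      subst₂ (λ n w → Walk Adj n v w)
        (sym (trans (cong height eq) (height-odd i)))
        (Fin.toℕ-injective (trans eq (sym base≡))) stop
      where
      base≡ : toℕ (base v) ≡ 2 * i + 1
      base≡ = trans (toℕ-cyc (pos< v))
        (cong (λ j → 2 * j + 1) (trans (cong ⌊_/2⌋ eq) (⌊odd/2⌋ i)))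

  cyc-cong : ∀ {i j} (i<L : i < L) (j<L : j < L) → i ≡ j → cyc i<L ≡ cyc j<L
  cyc-cong i<L j<L refl = cong cyc (<-irrelevant i<L j<L)

  forward : ∀ d {i j} (i<L : i < L) (j<L : j < L) → i + d ≡ j →
    Walk Adj d (cyc i<L) (cyc j<L)
  forward zero i<L j<L eq =
    subst (Walk Adj 0 _) (cyc-cong i<L j<L (trans (sym (+-identityʳ _)) eq)) stop
  forward (suc d) {i} {j} i<L j<L eq =
    step (fwd (subst₂ (StackedEdge L) (sym (toℕ-cyc i<L))
            (trans (2*i+3≡2*[1+i]+1 i) (sym (toℕ-cyc si<L)))
            (along i (subst (_≤ L) (+-comm 2 i) si<L))))
         (forward d si<L j<L si+d≡j)
    where
    si+d≡j : suc i + d ≡ j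
    si+d≡j = trans (sym (+-suc i d)) eq
    si<L : suc i < L
    si<L = ≤-<-trans (subst (suc i ≤_) si+d≡j (m≤m+n (suc i) d)) j<L

  -- The route takes `r` steps up to the last position `j + r`, the closing edge to position 0, and
  -- `i` steps from there.
  wrapAround : ∀ {i j r} (i<L : i < L) (j<L : j < L) → suc (j + r) ≡ L →
    Walk Adj (suc (r + i)) (cyc j<L) (cyc i<L)
  wrapAround {i} {j} {r} i<L j<L refl =
    subst (λ n → Walk Adj n (cyc j<L) (cyc i<L)) (+-suc r i)
      (forward r j<L last<L refl ++ʷ
        step (fwd (subst₂ (StackedEdge L)
               (trans (2*[1+i]∸1≡2*i+1 (j + r)) (sym (toℕ-cyc last<L)))
               (sym (toℕ-cyc 0<L)) closing))
             (forward i 0<L i<L refl))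
    where
    last<L : j + r < L
    last<L = ≤-refl
    0<L : 0 < L
    0<L = s≤s z≤n

  -- Descending to the cycle, following the arc and climbing to `v` realises the length. Minimality
  -- combines `walk-span` with `offset-≤`, where `2 * d ≤ L` says that the arc is no longer than its
  -- complement.
  isDistance : ∀ {u v d} → 1 ≤ L → u ≢ v → 2 * d ≤ L →
    Walk Adj d (base u) (base v) → Offset (pos u) (pos v) d →
    IsDistance Adj u v (ht u + (d + ht v))
  isDistance {u} {v} {d} 1≤L u≢v 2d≤L W off =
    descend u ++ʷ (W ++ʷ reverseʷ adj-sym (descend v)) , minimal
    where
    minimal : ∀ n → Walk Adj n u v → ht u + (d + ht v) ≤ n
    minimal n W′ with walk-span 1≤L W′
    ... | inj₁ u≡v = ⊥-elim (u≢v u≡v)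
    ... | inj₂ (p , q , sp , le) = begin
      ht u + (d + ht v)          ≡⟨ shuffle (ht u) d (ht v) ⟩
      ht u + ht v + d            ≤⟨ +-monoʳ-≤ (ht u + ht v) (offset-≤ 2d≤L off sp) ⟩
      ht u + ht v + (p + q)      ≤⟨ le ⟩
      n                          ∎
      where
      open ≤-Reasoning
      shuffle : ∀ a d b → a + (d + b) ≡ a + b + d
      shuffle = solve-∀

-- Short arcs and antipodes on a cycle of odd length

module _ (k : ℕ) where

  private
    L : ℕ
    L = 2 * k + 1

    1≤L : 1 ≤ L
    1≤L = m≤n+m 1 (2 * k)

    2d≤L : ∀ {d} → d ≤ k → 2 * d ≤ L
    2d≤L d≤k = ≤-trans (*-monoʳ-≤ 2 d≤k) (m≤m+n (2 * k) 1)

  Short : ∀ {i j} → i < L → j < L → Set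
  Short {i} {j} i<L j<L = ∃ λ d →
    d ≤ k × Walk (Adj L) d (cyc L i<L) (cyc L j<L) × Offset L i j d

  short-sym : ∀ {i j} (i<L : i < L) (j<L : j < L) → Short i<L j<L → Short j<L i<L
  short-sym _ _ (d , d≤k , W , off) =
    d , d≤k , reverseʷ (adj-sym L) W , offset-sym L off

  -- The two arcs between the positions have total length `2 * k + 1`, so one of them has length at
  -- most `k`.
  short-≤ : ∀ {i j} (i<L : i < L) (j<L : j < L) → i ≤ j → Short i<L j<L
  short-≤ {i} {j} i<L j<L i≤j with d , refl ← m≤n⇒∃[o]m+o≡n i≤j
    with ≤-<-connex d k
  ... | inj₁ d≤k = d , d≤k , forward L d i<L j<L refl , inj₁ (span 0 0 (shift i d))
    where
    shift : ∀ i d → i + d + 0 ≡ i + d + 0 + 0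
    shift = solve-∀
  ... | inj₂ k<d with r , eq ← m≤n⇒∃[o]m+o≡n j<L =
    -- With `r` positions beyond `j`, the complementary arc has length `L - d = suc (r + i)`.
    suc (r + i) , +-cancelˡ-≤ (suc k) _ _ (begin
      suc k + suc (r + i)      ≤⟨ +-monoˡ-≤ (suc (r + i)) k<d ⟩
      d + suc (r + i)          ≡⟨ shuffle d r i ⟩
      suc (i + d) + r          ≡⟨ eq ⟩
      2 * k + 1                ≡⟨ odd≡ k ⟩
      suc k + k                ∎) ,
    reverseʷ (adj-sym L) (wrapAround L i<L j<L eq) ,
    inj₂ (span 1 0 (trans (cong (λ n → i + 0 + 1 * n) (sym eq)) (shift i d r)))
    where
    open ≤-Reasoning
    shuffle : ∀ d r i → d + suc (r + i) ≡ suc (i + d) + r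
    shuffle = solve-∀
    odd≡ : ∀ k → 2 * k + 1 ≡ suc k + k
    odd≡ = solve-∀
    shift : ∀ i d r → i + 0 + 1 * (suc (i + d) + r) ≡ i + d + suc (r + i) + 0
    shift = solve-∀

  short : ∀ {i j} (i<L : i < L) (j<L : j < L) → Short i<L j<L
  short {i} {j} i<L j<L with ≤-total i j
  ... | inj₁ i≤j = short-≤ i<L j<L i≤j
  ... | inj₂ j≤i = short-sym j<L i<L (short-≤ j<L i<L j≤i)

  -- If `i + k` overshoots the cycle then `k ≤ i`, and stepping back by `k` stays in range; no
  -- wrapping occurs.
  antipode : ∀ {i} → i < L → ∃ λ j → j < L × (i + k ≡ j ⊎ j + k ≡ i)
  antipode {i} i<L with <-≤-connex (i + k) L
  ... | inj₁ i+k<L = i + k , i+k<L , inj₁ refl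
  ... | inj₂ L≤i+k = i ∸ k , ≤-<-trans (m∸n≤m i k) i<L , inj₂ (m∸n+n≡m k≤i)
    where
    split : ∀ k → 2 * k + 1 ≡ suc k + k
    split = solve-∀
    k≤i : k ≤ i
    k≤i = ≤-trans (n≤1+n k) (+-cancelʳ-≤ k (suc k) i (subst (_≤ i + k) (split k) L≤i+k))

  -- Eccentricities

  distance-≤ : ∀ v w → ∃ λ d → IsDistance (Adj L) v w d × d ≤ ht L v + (k + 1)
  distance-≤ v w with v Fin.≟ w
  ... | yes refl = 0 , (stop , λ _ _ → z≤n) , z≤n
  ... | no v≢w with d , d≤k , W , off ← short (pos< L v) (pos< L w) =
    _ , isDistance L 1≤L v≢w (2d≤L d≤k) W off ,
    +-monoʳ-≤ (ht L v) (+-mono-≤ d≤k (height≤1 (toℕ w)))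

  -- The pendant vertex over an antipodal position maximises both the arc length and the height of
  -- the far end. It differs from `v` because the positions are `k ≥ 1` apart.
  farthest : 1 ≤ k → ∀ v → ∃ λ w → IsDistance (Adj L) v w (ht L v + (k + 1))
  farthest 1≤k v with j , j<L , opp ← antipode (pos< L v) =
    w , subst (λ h → IsDistance (Adj L) v w (ht L v + (k + h))) ht≡
          (isDistance L 1≤L v≢w (2d≤L ≤-refl) (walk opp′) (off opp′))
    where
    w : StackedVertex L
    w = fromℕ< (even< j<L)
    toℕ-w : toℕ w ≡ 2 * j
    toℕ-w = Fin.toℕ-fromℕ< (even< j<L)
    ht≡ : ht L w ≡ 1
    ht≡ = trans (cong height toℕ-w) (height-even j)
    pos≡ : pos L w ≡ j
    pos≡ = trans (cong ⌊_/2⌋ toℕ-w) (⌊even/2⌋ j)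
    Opposite : Set
    Opposite = pos L v + k ≡ pos L w ⊎ pos L w + k ≡ pos L v
    opp′ : Opposite
    opp′ = subst (λ j → pos L v + k ≡ j ⊎ j + k ≡ pos L v) (sym pos≡) opp
    i+k≢i : ∀ {i} → i + k ≢ i
    i+k≢i {i} eq = <-irrefl (sym eq)
      (subst (_≤ i + k) (+-comm i 1) (+-monoʳ-≤ i 1≤k))
    v≢w : v ≢ w
    v≢w v≡w = [ (λ eq → i+k≢i (trans eq (sym p≡))) , (λ eq → i+k≢i (trans eq p≡)) ]′ opp′
      where
      p≡ : pos L v ≡ pos L w
      p≡ = cong (pos L) v≡w
    walk : Opposite → Walk (Adj L) k (base L v) (base L w)
    walk (inj₁ eq) = forward L k (pos< L v) (pos< L w) eq
    walk (inj₂ eq) = reverseʷ (adj-sym L) (forward L k (pos< L w) (pos< L v) eq)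
    off : Opposite → Offset L (pos L v) (pos L w) k
    off (inj₁ eq) = inj₁ (span 0 0 (cong (_+ 0) (trans eq (sym (+-identityʳ _)))))
    off (inj₂ eq) = inj₂ (span 0 0 (cong (_+ 0) (trans (+-identityʳ _) (sym eq))))

  eccentricity : 1 ≤ k → ∀ v → IsEccentricity (Adj L) v (ht L v + (k + 1))
  eccentricity 1≤k v = farthest 1≤k v , distance-≤ v

proposition30 : (p : ℕ) → Prime p → p % 120 ≡ 71 ⊎ p % 120 ≡ 119 →
    (P : Pred (K p) 0ℓ) → IsPrimeIdealAbove2 p P →
    (L : ℕ) → IsClassOrder p P L → 2 ∤ L → 3 ≤ L →
    (v : StackedVertex L) →
    (2 ∤ toℕ v → IsEccentricity (StackedAdj L) v ((L + 1) / 2)) ×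
    (2 ∣ toℕ v → IsEccentricity (StackedAdj L) v ((L + 3) / 2))
proposition30 _ _ _ _ _ L _ 2∤L 3≤L v with k , refl ← 2∤⇒odd 2∤L =
  -- With `L = 2 * k + 1`, the term `k + 1` is half of `L + 1`; the height adds 0 for odd `v` and 1
  -- for even `v`.
  (λ 2∤v → subst (IsEccentricity (StackedAdj L) v)
     (trans (cong (_+ (k + 1)) (2∤⇒height≡0 2∤v)) (half (k + 1) (double₁ k))) ecc) ,
  (λ 2∣v → subst (IsEccentricity (StackedAdj L) v)
     (trans (cong (_+ (k + 1)) (2∣⇒height≡1 2∣v)) (half (suc (k + 1)) (double₃ k))) ecc)
  where
  1≤k : 1 ≤ k
  1≤k = *-cancelˡ-≤ 2 (+-cancelʳ-≤ 1 2 (2 * k) 3≤L)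
  ecc : IsEccentricity (StackedAdj L) v (height (toℕ v) + (k + 1))
  ecc = eccentricity k 1≤k v
  half : ∀ {n} m → n ≡ m * 2 → m ≡ n / 2
  half m refl = sym (m*n/n≡m m 2)
  double₁ : ∀ k → 2 * k + 1 + 1 ≡ (k + 1) * 2
  double₁ = solve-∀
  double₃ : ∀ k → 2 * k + 1 + 3 ≡ suc (k + 1) * 2
  double₃ = solve-∀
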